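{- Let $E$ be an elliptic curve with complex multiplication by the ring $R=\operatorname{End}(E)$, let $\omega,\omega'\in R$, and let $\pi:E\to\mathbb{P}^1$ be the quotient map by the hyperelliptic involution. Let $\Delta=\{(P,P):P\in E\}\subsetneq E\times E$ and $\Delta'=\{(P,P):P\in\mathbb{P}^1\}\subsetneq\mathbb{P}^1\times\mathbb{P}^1$ be the diagonal subvarieties, so that $\Delta'=(\pi,\pi)(\Delta)$. Then $\Delta$ is pre-periodic for $[\omega]\times[\omega']:E\times E\to E\times E$ if and only if $\Delta'$ is pre-periodic for $\varphi_{[\omega]}\times\varphi_{[\omega']}:\mathbb{P}^1\times\mathbb{P}^1\to\mathbb{P}^1\times\mathbb{P}^1$.
   Context: The base field is algebraically closed of characteristic $0$; "complex multiplication" means that $R=\operatorname{End}(E)$ is strictly larger than $\mathbb{Z}$ (so $R$ is an order in an imaginary quadratic field). For $\omega\in R$, $[\omega]:E\to E$ denotes the corresponding endomorphism. The hyperelliptic involution is $P\mapsto -P$, and $\pi:E\to E/\{\pm1\}\cong\mathbb{P}^1$ is the quotient map. $\varphi_{[\omega]}:\mathbb{P}^1\to\mathbb{P}^1$ is the unique morphism with $\varphi_{[\omega]}\circ\pi=\pi\circ[\omega]$. The map $(\pi,\pi):E\times E\to\mathbb{P}^1\times\mathbb{P}^1$ is $(P,Q)\mapsto(\pi(P),\pi(Q))$, and $[\omega]\times[\omega']$ and $\varphi_{[\omega]}\times\varphi_{[\omega']}$ act coordinatewise. For a self-map $\varphi:X\to X$ of a projective variety, a subvariety $Y\subsetneq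 X$ is pre-periodic for $\varphi$ if there are integers $n\ge 0$ and $k>0$ with $\varphi^{n+k}(Y)=\varphi^{n}(Y)$, where $\varphi^m(Y)$ denotes the image of $Y$ under the $m$-th iterate of $\varphi$. -}

module Defs where

open import Algebra.Bundles using (AbelianGroup; CommutativeRing; Semiring)
import Algebra.Definitions.RawMonoid as RawMonoid
import Algebra.Definitions.RawSemiring as RawSemiring
open import Algebra.Morphism.Structures using (module GroupMorphisms)
open import Algebra.Structures using (IsAbelianGroup)
open import Data.Fin.Base using (Fin; inject₁; remQuot; suc; toℕ)
open import Data.Integer.Base using (ℤ; +_; -[1+_])
open import Data.List.Base using (List; [])
open import Data.List.Relation.Unary.All using (All)
open import Data.Nat.Base as ℕ using (ℕ; suc)
open import Data.Product.Base using (Σ; ∃; _×_; _,_; proj₁; proj₂)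
open import Data.Product.Relation.Binary.Pointwise.NonDependent using (×-setoid)
open import Data.Sum.Base using (_⊎_)
open import Data.Vec.Functional using (Vector)
import Function.Endo.Setoid as Endo
open import Function.Base using (_∘_)
open import Function.Bundles using (Func; _⇔_)
open import Function.Definitions using (StrictlySurjective)
open import Level using (Level; _⊔_) renaming (suc to lsuc)
open import Relation.Binary.Bundles using (Setoid)
import Relation.Binary.Construct.On as On
open import Relation.Nullary.Negation.Core using (¬_)
open import Relation.Unary using (Pred; _⊆_; _⊂_; _∪_; _≐_; Satisfiable)

private
  variable
    a b ℓ₁ ℓ₂ p : Level

------------------------------------------------------------------------
-- Pre-periodicity

Image : {A : Setoid a ℓ₁} {B : Setoid b ℓ₂} → Func A B →
        Pred (Setoid.Carrier A) p → Pred (Setoid.Carrier B) (a ⊔ ℓ₂ ⊔ p)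
Image {A = A} {B = B} f Y z = ∃ λ y → Y y × z ≈ Func.to f y
  where open Setoid B

PrePeriodic : {X : Setoid a ℓ₁} → Func X X → Pred (Setoid.Carrier X) p →
              Set (a ⊔ ℓ₁ ⊔ p)
PrePeriodic {X = X} f Y =
  ∃ λ n → ∃ λ k → 0 ℕ.< k × Image (f ^ (n ℕ.+ k)) Y ≐ Image (f ^ n) Y
  where open Endo X using (_^_)

Diagonal : (X : Setoid a ℓ₁) → Pred (Setoid.Carrier (×-setoid X X)) (a ⊔ ℓ₁)
Diagonal X z = ∃ λ x → z ≈ (x , x)
  where open Setoid (×-setoid X X)

------------------------------------------------------------------------
-- Algebraically closed fields of characteristic zero

record AlgebraicallyClosedField₀ c ℓ : Set (lsuc (c ⊔ ℓ)) where
  field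
    commutativeRing : CommutativeRing c ℓ

  open CommutativeRing commutativeRing public
  open RawSemiring (Semiring.rawSemiring semiring) using (_^_; sum) renaming (_×_ to _×ℕ_)

  field
    1≉0             : ¬ (1# ≈ 0#)
    inverse         : ∀ x → ¬ (x ≈ 0#) → ∃ λ y → x * y ≈ 1#
    -- Every monic polynomial of positive degree has a root.
    root            : ∀ n (coeff : Vector Carrier (suc n)) →
                      ∃ λ x → x ^ suc n + sum (λ i → coeff i * x ^ toℕ i) ≈ 0#
    characteristic₀ : ∀ n → ¬ (suc n ×ℕ 1# ≈ 0#)

------------------------------------------------------------------------
-- Projective algebraic sets over an algebraically closed field,
-- identified with their sets of rational points

module _ {c ℓ} (k : AlgebraicallyClosedField₀ c ℓ) where

  open AlgebraicallyClosedField₀ k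

  -- Expressions for homogeneous polynomials, graded by degree.
  data Form (m : ℕ) : ℕ → Set c where
    con : Carrier → Form m 0
    var : Fin m → Form m 1
    _⊕_ : ∀ {d} → Form m d → Form m d → Form m d
    _⊗_ : ∀ {d e} → Form m d → Form m e → Form m (d ℕ.+ e)

  eval : ∀ {m d} → Form m d → Vector Carrier m → Carrier
  eval (con a) x = a
  eval (var i) x = x i
  eval (f ⊕ g) x = eval f x + eval g x
  eval (f ⊗ g) x = eval f x * eval g x

  NonZero : ∀ {m} → Vector Carrier m → Set ℓ
  NonZero x = ∃ λ i → ¬ (x i ≈ 0#)

  Proportional : ∀ {m} → Vector Carrier m → Vector Carrier m → Set (c ⊔ ℓ)
  Proportional x y = ∃ λ a → ¬ (a ≈ 0#) × (∀ i → x i ≈ a * y i)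

  record Point (n : ℕ) : Set (c ⊔ ℓ) where
    field
      coord   : Vector Carrier (suc n)
      nonZero : NonZero coord

  open Point

  ℙ-setoid : ℕ → Setoid (c ⊔ ℓ) (c ⊔ ℓ)
  ℙ-setoid n = record
    { Carrier       = Point n
    ; _≈_           = λ P Q → Proportional (coord P) (coord Q)
    ; isEquivalence = record
      { refl  = 1# , 1≉0 , λ i → sym (*-identityˡ _)
      ; sym   = λ (a , a≉0 , x≈ay) →
          let (a⁻¹ , aa⁻¹≈1) = inverse a a≉0
              a⁻¹a≈1 = trans (*-comm a⁻¹ a) aa⁻¹≈1
          in a⁻¹
           , (λ a⁻¹≈0 → 1≉0 (trans (sym aa⁻¹≈1)
                               (trans (*-congˡ a⁻¹≈0) (zeroʳ a))))
           , (λ i → trans (sym (*-identityˡ _))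
                      (trans (*-congʳ (sym a⁻¹a≈1))
                        (trans (*-assoc _ _ _) (*-congˡ (sym (x≈ay i))))))
      ; trans = λ (a , a≉0 , x≈ay) (b , b≉0 , y≈bz) →
          let (a⁻¹ , aa⁻¹≈1) = inverse a a≉0
              a⁻¹a≈1 = trans (*-comm a⁻¹ a) aa⁻¹≈1
          in a * b
           , (λ ab≈0 → b≉0 (trans (sym (*-identityˡ b))
                              (trans (*-congʳ (sym a⁻¹a≈1))
                                (trans (*-assoc _ _ _)
                                  (trans (*-congˡ ab≈0) (zeroʳ a⁻¹))))))
           , (λ i → trans (x≈ay i)
                      (trans (*-congˡ (y≈bz i)) (sym (*-assoc _ _ _))))
      }
    }

  -- A closed subset of ℙⁿ, given by finitely many homogeneous equations.
  ClosedSet : ℕ → Set c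
  ClosedSet n = List (∃ λ d → Form (suc n) d)

  Zeros : ∀ {n} → ClosedSet n → Pred (Point n) (c ⊔ ℓ)
  Zeros Z P = All (λ (_ , f) → eval f (coord P) ≈ 0#) Z

  ℙ : (n : ℕ) → ClosedSet n
  ℙ n = []

  Points : ∀ {n} → ClosedSet n → Setoid (c ⊔ ℓ) (c ⊔ ℓ)
  Points {n} Z = On.setoid {B = Σ (Point n) (Zeros Z)} (ℙ-setoid n) proj₁

  Irreducible : ∀ {n} → ClosedSet n → Set (c ⊔ ℓ)
  Irreducible {n} Z =
    Satisfiable (Zeros Z) ×
    (∀ (Z₁ Z₂ : ClosedSet n) → Zeros Z ⊆ Zeros Z₁ ∪ Zeros Z₂ →
       (Zeros Z ⊆ Zeros Z₁) ⊎ (Zeros Z ⊆ Zeros Z₂))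

  record Chain {n} (Z : ClosedSet n) (d : ℕ) : Set (c ⊔ ℓ) where
    field
      link        : Fin (suc d) → ClosedSet n
      contained   : ∀ i → Zeros (link i) ⊆ Zeros Z
      irreducible : ∀ i → Irreducible (link i)
      strict      : ∀ (i : Fin d) → Zeros (link (inject₁ i)) ⊂ Zeros (link (suc i))

  HasDimension : ∀ {n} → ClosedSet n → ℕ → Set (c ⊔ ℓ)
  HasDimension Z d = Chain Z d × (∀ e → Chain Z e → e ℕ.≤ d)

  -- Let κ assign homogeneous coordinates to the elements of A.  Then φ is
  -- regular if near every element it is given by forms of a common degree
  -- without common zero.  Asking that the forms give φ wherever they do not
  -- all vanish is no restriction: a smaller neighbourhood can be enlarged by
  -- multiplying the forms by one that vanishes outside it.
  IsRegular : ∀ {A : Set a} {m n} →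
              (A → Vector Carrier m) → (A → Point n) → Set (a ⊔ c ⊔ ℓ)
  IsRegular {m = m} {n} κ φ =
    ∀ x → ∃ λ d → Σ (Fin (suc n) → Form m d) λ f →
      let f⟨_⟩ = λ y i → eval (f i) (κ y) in
      NonZero f⟨ x ⟩ ×
      (∀ y → NonZero f⟨ y ⟩ → Proportional f⟨ y ⟩ (coord (φ y)))

  record Morphism {m n} (Z : ClosedSet m) (W : ClosedSet n) : Set (c ⊔ ℓ) where
    field
      func    : Func (Points Z) (Points W)
      regular : IsRegular (coord ∘ proj₁) (proj₁ ∘ Func.to func)

    open Func func public using (to; cong)

  -- Homogeneous coordinates xᵢyⱼ of the Segre embedding.
  segre : ∀ {m n} → Vector Carrier m → Vector Carrier n → Vector Carrier (m ℕ.* n)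
  segre {n = n} x y l = let (i , j) = remQuot n l in x i * y j

  -- An elliptic curve as an abelian variety of dimension one: an irreducible
  -- projective curve with a commutative group law given by morphisms.
  -- Smoothness is automatic for group varieties, and the genus is then one.
  record EllipticCurve : Set (c ⊔ ℓ) where
    field
      {n}          : ℕ
      curve        : ClosedSet n
      irreducible  : Irreducible curve
      dimension    : HasDimension curve 1

    points : Setoid (c ⊔ ℓ) (c ⊔ ℓ)
    points = Points curve

    open Setoid points public using () renaming (Carrier to Pt; _≈_ to _≈ᴱ_)

    infixl 6 _+ᴱ_
    infix  8 -ᴱ_

    field
      _+ᴱ_           : Pt → Pt → Pt
      O              : Pt
      -ᴱ_            : Pt → Pt
      isAbelianGroup : IsAbelianGroup _≈ᴱ_ _+ᴱ_ O -ᴱ_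
      +ᴱ-regular     : IsRegular {A = Pt × Pt}
                                 (λ (P , Q) → segre (coord (proj₁ P)) (coord (proj₁ Q)))
                                 (λ (P , Q) → proj₁ (P +ᴱ Q))
      -ᴱ-regular     : IsRegular {A = Pt} (λ P → coord (proj₁ P)) (λ P → proj₁ (-ᴱ P))

    abelianGroup : AbelianGroup (c ⊔ ℓ) (c ⊔ ℓ)
    abelianGroup = record { isAbelianGroup = isAbelianGroup }

    open AbelianGroup abelianGroup public using (rawGroup; rawMonoid)
    open RawMonoid rawMonoid using () renaming (_×_ to _×ℕ_)

    infixr 8 _·_

    _·_ : ℤ → Pt → Pt
    (+ m)    · P = m ×ℕ P
    -[1+ m ] · P = -ᴱ (suc m ×ℕ P)

module _ {c ℓ} {k : AlgebraicallyClosedField₀ c ℓ} (E : EllipticCurve k) where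

  open EllipticCurve E

  record End : Set (c ⊔ ℓ) where
    field
      morphism       : Morphism k curve curve
      isHomomorphism : GroupMorphisms.IsGroupHomomorphism rawGroup rawGroup
                         (Morphism.to morphism)

    open Morphism morphism public

  -- ℤ → End E is not surjective.
  HasComplexMultiplication : Set (c ⊔ ℓ)
  HasComplexMultiplication =
    ∃ λ (ψ : End) → ∀ (m : ℤ) → ¬ (∀ P → End.to ψ P ≈ᴱ m · P)

  ℙ¹ : Setoid (c ⊔ ℓ) (c ⊔ ℓ)
  ℙ¹ = Points k (ℙ k 1)

  -- π identifies ℙ¹ with E/{±1}: its fibres are the orbits of the
  -- hyperelliptic involution, and every invariant morphism factors through it
  -- (uniquely, by surjectivity).
  record IsHyperellipticQuotient (π : Morphism k curve (ℙ k 1)) : Set (c ⊔ ℓ) where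
    open Setoid ℙ¹ using (_≈_)
    open Morphism π using (to)
    field
      surjective : StrictlySurjective _≈_ to
      fibres     : ∀ P Q → to P ≈ to Q ⇔ (P ≈ᴱ Q ⊎ P ≈ᴱ -ᴱ Q)
      universal  : ∀ {r} (W : ClosedSet k r) (f : Morphism k curve W) →
                   let open Setoid (Points k W) renaming (_≈_ to _≈ᵂ_) in
                   (∀ P → Morphism.to f (-ᴱ P) ≈ᵂ Morphism.to f P) →
                   ∃ λ (g : Morphism k (ℙ k 1) W) →
                     ∀ P → Morphism.to g (to P) ≈ᵂ Morphism.to f P

  -- The property φ ∘ π = π ∘ [ω], which determines φ since π is surjective.
  IsInduced : Morphism k curve (ℙ k 1) → End → Morphism k (ℙ k 1) (ℙ k 1) → Set (c ⊔ ℓ)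
  IsInduced π ω φ =
    ∀ P → Morphism.to φ (Morphism.to π P) ≈ Morphism.to π (End.to ω P)
    where open Setoid ℙ¹

module Submission where

-- The forward implication and the identity Δ' = (π,π)(Δ) are formal:
-- Π = (π,π) is surjective and intertwines F = [ω] × [ω'] with
-- Φ = φ × φ', so Φᵐ(Δ') = Π(Fᵐ(Δ)) for every m (Image-^-semiconj).
--
-- For the converse, put Γₘ = Fᵐ(Δ).  This is a subgroup of E × E, being the
-- image of a subgroup under a homomorphism.  Let σ(P , Q) = (P , -Q), an
-- involutive automorphism of E × E that commutes with F.  The fibre of Π
-- through z is {z , -z , σz , -σz}, so for subgroups H and K of E × E,
-- Π(H) ⊆ Π(K) gives H ⊆ K ∪ σ(K) (Image-reflects-⊆).  A group is never the
-- union of two proper subgroups, hence H ⊆ K or H ⊆ σ(K) (⊆-∪-subgroups, by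
-- excluded middle).  Suppose now that Π(Γₙ₊ₖ) = Π(Γₙ).  Applying this in both
-- directions and using σ² = 1 gives Γₙ₊ₖ = Γₙ or Γₙ₊ₖ = σ(Γₙ)
-- (≐-or-twisted).  In the second case
--   Γₙ₊₂ₖ = Fᵏ(σ(Γₙ)) = σ(Fᵏ(Γₙ)) = σ(Γₙ₊ₖ) = σ(σ(Γₙ)) = Γₙ,
-- so Δ is pre-periodic in either case (prePeriodic-up-to-involution).

open import Defs
open import Algebra.Bundles using (Group; AbelianGroup; RawGroup)
open import Algebra.Construct.DirectProduct using ()
  renaming (group to ×-group)
import Algebra.Morphism.Construct.Composition as Composition
import Algebra.Morphism.Construct.Identity as Identity
open import Algebra.Morphism.Structures using (module GroupMorphisms)
import Algebra.Properties.AbelianGroup as AbelianGroupProperties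
import Algebra.Properties.Group as GroupProperties
open import Algebra.Structures using (IsGroup; IsAbelianGroup)
open import Axiom.ExcludedMiddle using (ExcludedMiddle)
open import Data.Empty using (⊥-elim)
open import Data.Nat.Base as ℕ using (ℕ; zero; suc)
open import Data.Nat.Properties using (+-assoc; ≤-trans; m≤m+n)
open import Data.Product.Base using (_×_; ∃; _,_; proj₁; proj₂)
open import Data.Product.Function.NonDependent.Setoid using (_×-function_)
open import Data.Product.Relation.Binary.Pointwise.NonDependent using (×-setoid)
open import Data.Sum.Base using (_⊎_; inj₁; inj₂)
import Function.Construct.Identity as FunctionIdentity
import Function.Endo.Setoid as Endo
open import Function.Bundles using (Func; _⇔_; mk⇔; Equivalence)
open import Level using (Level; _⊔_)
open import Relation.Binary.Bundles using (Setoid)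
open import Relation.Binary.Definitions using (_Respects_)
open import Relation.Binary.PropositionalEquality.Core using (subst)
open import Relation.Nullary.Decidable.Core using (yes; no)
open import Relation.Nullary.Negation.Core using (¬_)
open import Relation.Unary using (Pred; _⊆_; _∪_; _≐_)
open import Relation.Unary.Properties using (≐-sym; ≐-trans)

private
  variable
    a b ℓ₁ ℓ₂ p q : Level
    X : Setoid a ℓ₁
    Y : Setoid b ℓ₂

-- Images of subsets

Image-mono : (f : Func X Y) {P : Pred (Setoid.Carrier X) p} {Q : Pred (Setoid.Carrier X) q} →
             P ⊆ Q → Image f P ⊆ Image f Q
Image-mono f P⊆Q (x , Px , y≈fx) = x , P⊆Q Px , y≈fx

Image-cong : (f : Func X Y) {P : Pred (Setoid.Carrier X) p} {Q : Pred (Setoid.Carrier X) q} →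
             P ≐ Q → Image f P ≐ Image f Q
Image-cong f (P⊆Q , Q⊆P) = Image-mono f P⊆Q , Image-mono f Q⊆P

Image-involution : (σ : Func X X) → let open Setoid X in
                   (∀ x → Func.to σ (Func.to σ x) ≈ x) →
                   {P : Pred Carrier p} → P Respects _≈_ →
                   Image σ (Image σ P) ⊆ P
Image-involution {X = X} σ σσ≈id resp (y , (x , Px , y≈σx) , z≈σy) =
  resp (sym (trans z≈σy (trans (Func.cong σ y≈σx) (σσ≈id x)))) Px
  where open Setoid X

module _ {X : Setoid a ℓ₁} (f : Func X X) where

  open Endo X using (_^_; ^-homo)
  open Setoid X

  Image-^-+ : (P : Pred Carrier p) → ∀ m n →
              Image (f ^ (m ℕ.+ n)) P ≐ Image (f ^ n) (Image (f ^ m) P)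
  Image-^-+ P m n
    = (λ (x , Px , z≈) → Func.to (f ^ m) x , (x , Px , refl)
                       , trans z≈ (^-homo f m n x))
    , (λ (y , (x , Px , y≈) , z≈) → x , Px
                       , trans z≈ (trans (Func.cong (f ^ n) y≈) (sym (^-homo f m n x))))

module _ {X : Setoid a ℓ₁} {Y : Setoid b ℓ₂}
         (h : Func X Y) (f : Func X X) (g : Func Y Y)
         (semiconj : ∀ x → Setoid._≈_ Y (Func.to g (Func.to h x)) (Func.to h (Func.to f x)))
         where

  open Endo X using () renaming (_^_ to _^ˣ_)
  open Endo Y using () renaming (_^_ to _^ʸ_)
  open Setoid Y
  open Func

  ^-semiconj : ∀ n x → to (g ^ʸ n) (to h x) ≈ to h (to (f ^ˣ n) x)
  ^-semiconj zero    x = refl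
  ^-semiconj (suc n) x = trans (cong (g ^ʸ n) (semiconj x)) (^-semiconj n (to f x))

  Image-^-semiconj : (P : Pred (Setoid.Carrier X) p) → ∀ n →
                     Image (g ^ʸ n) (Image h P) ≐ Image h (Image (f ^ˣ n) P)
  Image-^-semiconj P n
    = (λ (y , (x , Px , y≈hx) , z≈) → to (f ^ˣ n) x , (x , Px , Setoid.refl X)
         , trans z≈ (trans (cong (g ^ʸ n) y≈hx) (^-semiconj n x)))
    , (λ (y , (x , Px , y≈) , z≈) → to h x , (x , Px , refl)
         , trans z≈ (trans (cong h y≈) (sym (^-semiconj n x))))

Diagonal≐Image-Diagonal :
  (h : Func X Y) → (∀ y → ∃ λ x → Setoid._≈_ Y (Func.to h x) y) →
  Diagonal Y ≐ Image (h ×-function h) (Diagonal X)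
Diagonal≐Image-Diagonal {X = X} {Y = Y} h surjective
  = (λ (y , z₁≈y , z₂≈y) → let (x , hx≈y) = surjective y in
       (x , x) , (x , Setoid.refl X , Setoid.refl X)
       , trans z₁≈y (sym hx≈y) , trans z₂≈y (sym hx≈y))
  , (λ (_ , (x , w₁≈x , w₂≈x) , z₁≈hw₁ , z₂≈hw₂) → Func.to h x
       , trans z₁≈hw₁ (Func.cong h w₁≈x) , trans z₂≈hw₂ (Func.cong h w₂≈x))
  where open Setoid Y

-- Subgroups

-- A subset of a group, stable under its equality, that contains the unit and
-- is closed under products and inverses.
record IsSubgroup (G : RawGroup a ℓ₁) (H : Pred (RawGroup.Carrier G) p) :
                  Set (a ⊔ ℓ₁ ⊔ p) where
  open RawGroup G
  field
    resp      : H Respects _≈_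
    ∙-closed  : ∀ {x y} → H x → H y → H (x ∙ y)
    ε-closed  : H ε
    ⁻¹-closed : ∀ {x} → H x → H (x ⁻¹)

-- A group is not the union of two proper subgroups: if x ∈ H lies outside K,
-- then y ∈ H ∩ K forces x ∙ y ∉ K, so x and x ∙ y both lie in L.
⊆-∪-subgroups : (G : Group a ℓ₁) → ExcludedMiddle a →
                {H K L : Pred (Group.Carrier G) a} →
                IsSubgroup (Group.rawGroup G) H →
                IsSubgroup (Group.rawGroup G) K →
                IsSubgroup (Group.rawGroup G) L →
                H ⊆ K ∪ L → (H ⊆ K) ⊎ (H ⊆ L)
⊆-∪-subgroups G em {H} {K} {L} subH subK subL H⊆K∪L
  with em {∃ λ x → H x × ¬ K x}
... | no ∄x = inj₁ H⊆K
  where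
  H⊆K : H ⊆ K
  H⊆K {y} Hy with em {K y}
  ... | yes Ky = Ky
  ... | no ¬Ky = ⊥-elim (∄x (y , Hy , ¬Ky))
... | yes (x , Hx , ¬Kx) = inj₂ H⊆L
  where
  open Group G
  open GroupProperties G using (//-rightDividesʳ; \\-leftDividesʳ)
  module H = IsSubgroup subH
  module K = IsSubgroup subK
  module L = IsSubgroup subL

  L-unless-K : ∀ {y} → H y → ¬ K y → L y
  L-unless-K Hy ¬Ky with H⊆K∪L Hy
  ... | inj₁ Ky = ⊥-elim (¬Ky Ky)
  ... | inj₂ Ly = Ly

  H⊆L : H ⊆ L
  H⊆L {y} Hy with H⊆K∪L Hy
  ... | inj₂ Ly = Ly
  ... | inj₁ Ky = L.resp (\\-leftDividesʳ x y)
                    (L.∙-closed (L.⁻¹-closed (L-unless-K Hx ¬Kx)) Lxy)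
    where
    Lxy : L (x ∙ y)
    Lxy = L-unless-K (H.∙-closed Hx Hy) λ Kxy →
      ¬Kx (K.resp (//-rightDividesʳ y x) (K.∙-closed Kxy (K.⁻¹-closed Ky)))

-- The group structure is given on a fixed setoid X, so that iterates of
-- endofunctions of X are the ones in terms of which pre-periodicity is defined.
module _ {X : Setoid a ℓ₁} {_∙_ ε _⁻¹}
         (isGroup : IsGroup (Setoid._≈_ X) _∙_ ε _⁻¹) where

  open Setoid X

  private
    G : Group a ℓ₁
    G = record { isGroup = isGroup }

  open Group G using (rawGroup; ∙-cong; ⁻¹-cong)
  open GroupMorphisms rawGroup rawGroup using (IsGroupHomomorphism)
  open Endo X using (_^_)

  Image-isSubgroup : (f : Func X X) → IsGroupHomomorphism (Func.to f) →
                     {H : Pred Carrier p} → IsSubgroup rawGroup H →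
                     IsSubgroup rawGroup (Image f H)
  Image-isSubgroup f f-hom subH = record
    { resp      = λ z≈w (x , Hx , z≈fx) → x , Hx , trans (sym z≈w) z≈fx
    ; ∙-closed  = λ (x , Hx , z≈fx) (y , Hy , w≈fy) →
        _ , H.∙-closed Hx Hy , trans (∙-cong z≈fx w≈fy) (sym (f.homo x y))
    ; ε-closed  = _ , H.ε-closed , sym f.ε-homo
    ; ⁻¹-closed = λ (x , Hx , z≈fx) →
        _ , H.⁻¹-closed Hx , trans (⁻¹-cong z≈fx) (sym (f.⁻¹-homo x))
    }
    where
    module H = IsSubgroup subH
    module f = IsGroupHomomorphism f-hom

  ^-isGroupHomomorphism : (f : Func X X) → IsGroupHomomorphism (Func.to f) →
                          ∀ n → IsGroupHomomorphism (Func.to (f ^ n))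
  ^-isGroupHomomorphism f f-hom zero    = Identity.isGroupHomomorphism rawGroup refl
  ^-isGroupHomomorphism f f-hom (suc n) =
    Composition.isGroupHomomorphism trans f-hom (^-isGroupHomomorphism f f-hom n)

-- Pre-periodicity up to an involution

-- Containments in both directions, each up to σ, force equality up to σ.
-- When only one of them is twisted by σ, the other shows that the sets agree.
≐-or-twisted : (σ : Func X X) → let open Setoid X in
               (∀ x → Func.to σ (Func.to σ x) ≈ x) →
               {H : Pred Carrier p} {K : Pred Carrier q} → H Respects _≈_ → K Respects _≈_ →
               (H ⊆ K) ⊎ (H ⊆ Image σ K) → (K ⊆ H) ⊎ (K ⊆ Image σ H) →
               (H ≐ K) ⊎ (H ≐ Image σ K)
≐-or-twisted σ σσ≈id {H} {K} respH respK = λ where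
    (inj₁ H⊆K)  (inj₁ K⊆H)  → inj₁ (H⊆K , K⊆H)
    (inj₁ H⊆K)  (inj₂ K⊆σH) → inj₁ (H⊆K , λ Kx → untwist K⊆σH (Image-mono σ H⊆K (K⊆σH Kx)))
    (inj₂ H⊆σK) (inj₁ K⊆H)  → inj₁ ((λ Hx → untwist′ H⊆σK (Image-mono σ K⊆H (H⊆σK Hx))) , K⊆H)
    (inj₂ H⊆σK) (inj₂ K⊆σH) → inj₂ (H⊆σK , untwist K⊆σH)
  where
  untwist : K ⊆ Image σ H → Image σ K ⊆ H
  untwist K⊆σH σKx = Image-involution σ σσ≈id respH (Image-mono σ K⊆σH σKx)

  untwist′ : H ⊆ Image σ K → Image σ H ⊆ K
  untwist′ H⊆σK σHx = Image-involution σ σσ≈id respK (Image-mono σ H⊆σK σHx)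

module _ {X : Setoid a a} {_∙_ ε _⁻¹}
         (isGroup : IsGroup (Setoid._≈_ X) _∙_ ε _⁻¹) (em : ExcludedMiddle a) where

  open Setoid X

  private
    G : Group a a
    G = record { isGroup = isGroup }

  open Group G using (rawGroup)
  open GroupMorphisms rawGroup rawGroup using (IsGroupHomomorphism)
  open Endo X using (_^_)

  -- With Γₘ = fᵐ(D), the two inclusions say that Γₙ₊ₖ and Γₙ agree up to σ,
  -- one element at a time.  Since all these sets are subgroups, the choice of
  -- sign can be made uniformly.
  prePeriodic-up-to-involution :
    (f σ : Func X X) →
    IsGroupHomomorphism (Func.to f) → IsGroupHomomorphism (Func.to σ) →
    (∀ x → Func.to σ (Func.to σ x) ≈ x) →
    (∀ x → Func.to f (Func.to σ x) ≈ Func.to σ (Func.to f x)) →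
    {D : Pred Carrier a} → IsSubgroup rawGroup D → ∀ n k → 0 ℕ.< k →
    Image (f ^ (n ℕ.+ k)) D ⊆ Image (f ^ n) D ∪ Image σ (Image (f ^ n) D) →
    Image (f ^ n) D ⊆ Image (f ^ (n ℕ.+ k)) D ∪ Image σ (Image (f ^ (n ℕ.+ k)) D) →
    PrePeriodic f D
  prePeriodic-up-to-involution f σ f-hom σ-hom σσ≈id fσ≈σf {D} subD n k 0<k incl incl′ =
    conclude (≐-or-twisted σ σσ≈id (IsSubgroup.resp (subΓ (n ℕ.+ k))) (IsSubgroup.resp (subΓ n))
           (alternative (n ℕ.+ k) n incl) (alternative n (n ℕ.+ k) incl′))
    where
    Γ : ℕ → Pred Carrier a
    Γ m = Image (f ^ m) D

    subΓ : ∀ m → IsSubgroup rawGroup (Γ m)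
    subΓ m = Image-isSubgroup isGroup (f ^ m) (^-isGroupHomomorphism isGroup f f-hom m) subD

    alternative : ∀ l m → Γ l ⊆ Γ m ∪ Image σ (Γ m) → (Γ l ⊆ Γ m) ⊎ (Γ l ⊆ Image σ (Γ m))
    alternative l m = ⊆-∪-subgroups G em (subΓ l) (subΓ m)
                        (Image-isSubgroup isGroup σ σ-hom (subΓ m))

    conclude : (Γ (n ℕ.+ k) ≐ Γ n) ⊎ (Γ (n ℕ.+ k) ≐ Image σ (Γ n)) → PrePeriodic f D
    conclude (inj₁ Γₙ₊ₖ≐Γₙ)  = n , k , 0<k , Γₙ₊ₖ≐Γₙ
    conclude (inj₂ Γₙ₊ₖ≐σΓₙ) =
      n , k ℕ.+ k , ≤-trans 0<k (m≤m+n k k) ,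
      subst (λ m → Γ m ≐ Γ n) (+-assoc n k k)
        (≐-trans (Image-^-+ f D (n ℕ.+ k) k)
        (≐-trans (Image-cong (f ^ k) Γₙ₊ₖ≐σΓₙ)
        (≐-trans (Image-^-semiconj σ f f fσ≈σf (Γ n) k)
        (≐-trans (Image-cong σ (≐-sym (Image-^-+ f D n k)))
        (≐-trans (Image-cong σ Γₙ₊ₖ≐σΓₙ)
                 σσΓₙ≐Γₙ)))))
      where
      σσΓₙ≐Γₙ : Image σ (Image σ (Γ n)) ≐ Γ n
      σσΓₙ≐Γₙ = Image-involution σ σσ≈id (IsSubgroup.resp (subΓ n))
              , λ {x} Γx → _ , (x , Γx , refl) , sym (σσ≈id x)

-- The square of an abelian group modulo sign

module _ {X : Setoid a a} {_∙_ ε _⁻¹}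
         (isAbelianGroup : IsAbelianGroup (Setoid._≈_ X) _∙_ ε _⁻¹) where

  open Setoid X

  private
    A : AbelianGroup a a
    A = record { isAbelianGroup = isAbelianGroup }

    module A = AbelianGroup A

    X² : Setoid a a
    X² = ×-setoid X X

    A² : Group a a
    A² = ×-group A.group A.group

  open AbelianGroupProperties A using (⁻¹-∙-comm; ⁻¹-involutive; ε⁻¹≈ε)
  open Group A² using () renaming (rawGroup to rawA²)
  open GroupMorphisms

  inversion : Func X X
  inversion = record { to = _⁻¹ ; cong = A.⁻¹-cong }

  inversion-isGroupHomomorphism : IsGroupHomomorphism A.rawGroup A.rawGroup _⁻¹
  inversion-isGroupHomomorphism = record
    { isMonoidHomomorphism = record
      { isMagmaHomomorphism = record
        { isRelHomomorphism = record { cong = A.⁻¹-cong }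
        ; homo              = λ x y → sym (⁻¹-∙-comm x y)
        }
      ; ε-homo = ε⁻¹≈ε
      }
    ; ⁻¹-homo = λ _ → refl
    }

  -- The automorphism (x , y) ↦ (x , y ⁻¹).
  σ : Func X² X²
  σ = FunctionIdentity.function X ×-function inversion

  ×-isGroupHomomorphism : ∀ {f g} →
    IsGroupHomomorphism A.rawGroup A.rawGroup (Func.to {From = X} {To = X} f) →
    IsGroupHomomorphism A.rawGroup A.rawGroup (Func.to {From = X} {To = X} g) →
    IsGroupHomomorphism rawA² rawA² (Func.to (f ×-function g))
  ×-isGroupHomomorphism {f} {g} f-hom g-hom = record
    { isMonoidHomomorphism = record
      { isMagmaHomomorphism = record
        { isRelHomomorphism = record { cong = Func.cong (f ×-function g) }
        ; homo              = λ (x , y) (x′ , y′) → f.homo x x′ , g.homo y y′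
        }
      ; ε-homo = f.ε-homo , g.ε-homo
      }
    ; ⁻¹-homo = λ (x , y) → f.⁻¹-homo x , g.⁻¹-homo y
    }
    where
    module f = IsGroupHomomorphism f-hom
    module g = IsGroupHomomorphism g-hom

  Diagonal-isSubgroup : IsSubgroup rawA² (Diagonal X)
  Diagonal-isSubgroup = record
    { resp      = λ (p , q) (x , p′ , q′) → x , trans (sym p) p′ , trans (sym q) q′
    ; ∙-closed  = λ (x , p , q) (x′ , p′ , q′) → _ , A.∙-cong p p′ , A.∙-cong q q′
    ; ε-closed  = _ , refl , refl
    ; ⁻¹-closed = λ (x , p , q) → _ , A.⁻¹-cong p , A.⁻¹-cong q
    }

  -- Each fibre of π lies in one orbit of inversion, so π(z) = π(w)
  -- coordinatewise puts z among w, σ w and their inverses, and the inverse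
  -- signs are absorbed by K.
  Image-reflects-⊆ : {S : Setoid b ℓ₂} (π : Func X S) →
    (∀ x y → Setoid._≈_ S (Func.to π x) (Func.to π y) → x ≈ y ⊎ x ≈ y ⁻¹) →
    {H : Pred (Setoid.Carrier X²) p} {K : Pred (Setoid.Carrier X²) q} → IsSubgroup rawA² K →
    Image (π ×-function π) H ⊆ Image (π ×-function π) K → H ⊆ K ∪ Image σ K
  Image-reflects-⊆ {S = S} π fibres {H} {K} subK ΠH⊆ΠK {z@(z₁ , z₂)} Hz
    with ΠH⊆ΠK (z , Hz , Setoid.refl S , Setoid.refl S)
  ... | (w@(w₁ , w₂) , Kw , πz₁≈πw₁ , πz₂≈πw₂)
    with fibres z₁ w₁ πz₁≈πw₁ | fibres z₂ w₂ πz₂≈πw₂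
  ... | inj₁ z₁≈w₁  | inj₁ z₂≈w₂  = inj₁ (K.resp (sym z₁≈w₁ , sym z₂≈w₂) Kw)
    where module K = IsSubgroup subK
  ... | inj₁ z₁≈w₁  | inj₂ z₂≈-w₂ = inj₂ (w , Kw , z₁≈w₁ , z₂≈-w₂)
  ... | inj₂ z₁≈-w₁ | inj₁ z₂≈w₂  =
    inj₂ (_ , K.⁻¹-closed Kw , z₁≈-w₁ , trans z₂≈w₂ (sym (⁻¹-involutive w₂)))
    where module K = IsSubgroup subK
  ... | inj₂ z₁≈-w₁ | inj₂ z₂≈-w₂ =
    inj₁ (K.resp (sym z₁≈-w₁ , sym z₂≈-w₂) (K.⁻¹-closed Kw))
    where module K = IsSubgroup subK

  module _ (f g : Func X X)
           (f-hom : IsGroupHomomorphism A.rawGroup A.rawGroup (Func.to f))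
           (g-hom : IsGroupHomomorphism A.rawGroup A.rawGroup (Func.to g))
           {S : Setoid b ℓ₂} (π : Func X S) (φ ψ : Func S S)
           (surjective : ∀ s → ∃ λ x → Setoid._≈_ S (Func.to π x) s)
           (φπ≈πf : ∀ x → Setoid._≈_ S (Func.to φ (Func.to π x)) (Func.to π (Func.to f x)))
           (ψπ≈πg : ∀ x → Setoid._≈_ S (Func.to ψ (Func.to π x)) (Func.to π (Func.to g x)))
           where

    private
      module S = Setoid S
      F = f ×-function g
      Π = π ×-function π
      Φ = φ ×-function ψ

    open Endo X² using (_^_)
    open Endo (×-setoid S S) using () renaming (_^_ to _^ˢ_)

    Image-Diagonal : ∀ m → Image (Φ ^ˢ m) (Diagonal S) ≐ Image Π (Image (F ^ m) (Diagonal X))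
    Image-Diagonal m =
      ≐-trans (Image-cong (Φ ^ˢ m) (Diagonal≐Image-Diagonal π surjective))
              (Image-^-semiconj Π F Φ (λ (x , y) → φπ≈πf x , ψπ≈πg y) (Diagonal X) m)

    prePeriodic-Diagonal :
      ExcludedMiddle a →
      (∀ x y → Func.to π x S.≈ Func.to π y → x ≈ y ⊎ x ≈ y ⁻¹) →
      PrePeriodic F (Diagonal X) ⇔ PrePeriodic Φ (Diagonal S)
    prePeriodic-Diagonal em fibres = mk⇔ down up
      where
      down : PrePeriodic F (Diagonal X) → PrePeriodic Φ (Diagonal S)
      down (n , k , 0<k , eq) = n , k , 0<k ,
        ≐-trans (Image-Diagonal (n ℕ.+ k))
          (≐-trans (Image-cong Π eq) (≐-sym (Image-Diagonal n)))

      F-hom : IsGroupHomomorphism rawA² rawA² (Func.to F)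
      F-hom = ×-isGroupHomomorphism {f} {g} f-hom g-hom

      σ-hom : IsGroupHomomorphism rawA² rawA² (Func.to σ)
      σ-hom = ×-isGroupHomomorphism {FunctionIdentity.function X} {inversion}
                (Identity.isGroupHomomorphism A.rawGroup refl) inversion-isGroupHomomorphism

      up : PrePeriodic Φ (Diagonal S) → PrePeriodic F (Diagonal X)
      up (n , k , 0<k , eq) =
        prePeriodic-up-to-involution {X = X²} (Group.isGroup A²) em F σ F-hom σ-hom
          (λ (x , y) → refl , ⁻¹-involutive y)
          (λ (x , y) → refl , IsGroupHomomorphism.⁻¹-homo g-hom y)
          Diagonal-isSubgroup n k 0<k
          (Image-reflects-⊆ π fibres (subΓ n) (proj₁ eqΠ))
          (Image-reflects-⊆ π fibres (subΓ (n ℕ.+ k)) (proj₂ eqΠ))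
        where
        subΓ : ∀ m → IsSubgroup rawA² (Image (F ^ m) (Diagonal X))
        subΓ m = Image-isSubgroup {X = X²} (Group.isGroup A²) (F ^ m)
          (^-isGroupHomomorphism {X = X²} (Group.isGroup A²) F F-hom m) Diagonal-isSubgroup

        eqΠ : Image Π (Image (F ^ (n ℕ.+ k)) (Diagonal X)) ≐ Image Π (Image (F ^ n) (Diagonal X))
        eqΠ = ≐-trans (≐-sym (Image-Diagonal (n ℕ.+ k))) (≐-trans eq (Image-Diagonal n))

-- Elliptic curves

theorem1p3 :
  ∀ {c ℓ : Level} → ExcludedMiddle (c ⊔ ℓ) →
  (k : AlgebraicallyClosedField₀ c ℓ) (E : EllipticCurve k) →
  HasComplexMultiplication E →
  (ω ω' : End E) →
  (π : Morphism k (EllipticCurve.curve E) (ℙ k 1)) → IsHyperellipticQuotient E π →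
  (φ φ' : Morphism k (ℙ k 1) (ℙ k 1)) → IsInduced E π ω φ → IsInduced E π ω' φ' →
  let Δ  = Diagonal (EllipticCurve.points E)
      Δ' = Diagonal (ℙ¹ E)
  in (Δ' ≐ Image (Morphism.func π ×-function Morphism.func π) Δ)
     × (PrePeriodic (End.func ω ×-function End.func ω') Δ
        ⇔ PrePeriodic (Morphism.func φ ×-function Morphism.func φ') Δ')
theorem1p3 em k E _ ω ω' π quotient φ φ' induced induced' =
  Diagonal≐Image-Diagonal (Morphism.func π) surjective ,
  prePeriodic-Diagonal isAbelianGroup
    (End.func ω) (End.func ω') (End.isHomomorphism ω) (End.isHomomorphism ω')
    (Morphism.func π) (Morphism.func φ) (Morphism.func φ') surjective induced induced'
    em (λ P Q → Equivalence.to (fibres P Q))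
  where
  open EllipticCurve E using (isAbelianGroup)
  open IsHyperellipticQuotient quotient using (surjective; fibres)
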